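{- The set of simple involutions avoiding the pattern $2341$ is exactly the union of the set of simple involutions avoiding $123$ with the single permutation $5274163$.
   Context: An involution is a permutation equal to its own inverse. A permutation $\pi$ avoids $\sigma$ if no subsequence of $\pi$ has the same relative order as $\sigma$. An interval of $\pi_1\cdots\pi_n$ is a set of positionally contiguous entries whose values form a set of consecutive integers; $\pi$ is simple if its only intervals have size $1$ or $n$. -}

module Defs where

open import Data.Nat using (ℕ; zero; suc; _+_; _∸_; _≤_; _<_)
open import Data.Fin using (Fin; toℕ) renaming (_<_ to _<ᶠ_; _≤_ to _≤ᶠ_)
open import Data.Fin.Permutation using (Permutation′; _⟨$⟩ʳ_)
open import Data.Vec using (Vec; lookup; _∷_; [])
open import Data.Product using (Σ; ∃; _×_; _,_)
open import Data.Sum using (_⊎_)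
open import Relation.Binary.PropositionalEquality using (_≡_)
open import Relation.Nullary using (¬_)
open import Function.Bundles using (_⇔_)

-- A permutation of [n] = {1..n} is represented by a stdlib permutation of Fin n
-- (positions 0..n-1, values 0..n-1; shift by one relative to the paper).

IsInvolution : ∀ {n} → Permutation′ n → Set
IsInvolution π = ∀ i → π ⟨$⟩ʳ (π ⟨$⟩ʳ i) ≡ i

Contains : ∀ {n k} → Permutation′ n → Permutation′ k → Set
Contains {n} {k} π σ =
  Σ (Fin k → Fin n) λ f →
    (∀ a b → a <ᶠ b → f a <ᶠ f b) ×
    (∀ a b → (σ ⟨$⟩ʳ a <ᶠ σ ⟨$⟩ʳ b) ⇔ (π ⟨$⟩ʳ f a <ᶠ π ⟨$⟩ʳ f b))

Avoids : ∀ {n k} → Permutation′ n → Permutation′ k → Set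
Avoids π σ = ¬ Contains π σ

IsInterval : ∀ {n} → Permutation′ n → Fin n → Fin n → Set
IsInterval {n} π i j =
  i ≤ᶠ j ×
  ∃ λ (a : ℕ) → ∀ (v : Fin n) →
    (∃ λ (p : Fin n) → i ≤ᶠ p × p ≤ᶠ j × π ⟨$⟩ʳ p ≡ v) ⇔
    (a ≤ toℕ v × toℕ v ≤ a + (toℕ j ∸ toℕ i))

IsSimple : ∀ {n} → Permutation′ n → Set
IsSimple {n} π = ∀ i j → IsInterval π i j →
  (suc (toℕ j ∸ toℕ i) ≡ 1) ⊎ (suc (toℕ j ∸ toℕ i) ≡ n)

HasOneLine : ∀ {n} → Permutation′ n → Vec ℕ n → Set
HasOneLine π w = ∀ i → toℕ (π ⟨$⟩ʳ i) ≡ lookup w i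

Is5274163 : ∀ {n} → Permutation′ n → Set
Is5274163 {n} π = Σ (n ≡ 7) λ { _≡_.refl → HasOneLine π (4 ∷ 1 ∷ 6 ∷ 3 ∷ 0 ∷ 5 ∷ 2 ∷ []) }

Avoids2341 : ∀ {n} → Permutation′ n → Set
Avoids2341 π = ∀ (σ : Permutation′ 4) → HasOneLine σ (1 ∷ 2 ∷ 3 ∷ 0 ∷ []) → Avoids π σ

Avoids123 : ∀ {n} → Permutation′ n → Set
Avoids123 π = ∀ (σ : Permutation′ 3) → HasOneLine σ (0 ∷ 1 ∷ 2 ∷ []) → Avoids π σ

{-# OPTIONS --safe #-}
module Submission where

-- If the middle entry of an occurrence of 123 in the involution π is not a fixed point, it may be
-- taken to be an excedance, since π = π⁻¹.  Starting from that entry, draw more and more entries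
-- of π together with their mirror images in the diagonal.  The entries drawn cut the plane into
-- cells.  A cell is either empty or has a leftmost entry, which is drawn next; it is certainly
-- empty if an entry there would complete a 2341 with the entries drawn.  A branch of this case
-- distinction dies when an end of the 123 has no cell left, or when the empty cells force some
-- consecutive columns and consecutive rows to contain the same entries, against simplicity.
-- For suitably chosen cells the tree is finite and small, and in the only surviving leaf the
-- entries drawn form 5274163 and all cells are empty.

open import Defs
open import Data.Nat as ℕ using (ℕ; zero; suc; _+_; _∸_; _≤_; _<_; z≤n; s≤s; s≤s⁻¹)
open import Data.Fin.Permutation using (Permutation′; _⟨$⟩ʳ_; permutation) renaming (id to id↔)
open import Data.Product using (Σ; _×_; _,_; proj₁; proj₂; ∃-syntax)
open import Data.Sum using (_⊎_; inj₁; inj₂)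
open import Function.Bundles using (_⇔_; mk⇔; module Equivalence; module Injection)
open import Data.Fin as Fin using (Fin; zero; suc; toℕ; fromℕ; inject₁; punchIn; #_)
open import Data.Fin.Properties as Fin using (any?; all?)
open import Data.List as List using (List; []; _∷_)
open import Data.List.Relation.Unary.All as All using (All; []; _∷_)
import Data.List.Relation.Unary.All.Properties as All
open import Data.List.Relation.Unary.Any as Any using (Any)
open import Data.Nat.Properties
open import Data.Unit using (tt)
open import Data.Vec as Vec using (Vec; []; _∷_; lookup; insertAt)
open import Data.Vec.Properties as Vec using (insertAt-lookup; insertAt-punchIn; lookup-map)
open import Function using (_∘_; case_of_)
open import Function.Properties.Inverse using (↔⇒↣)
open import Relation.Binary.Definitions using (tri<; tri≈; tri>)
open import Relation.Binary.PropositionalEquality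
  using (_≡_; _≢_; refl; sym; trans; cong; cong₂; subst; subst₂; module ≡-Reasoning)
open import Relation.Nullary using (Dec; yes; no; ¬_; contradiction)
open import Relation.Nullary.Decidable using (True; toWitness; ¬?; _×-dec_; _⊎-dec_; _→-dec_)

private
  variable
    m : ℕ

-- Occurrences of 123 and 2341 as searchable predicates

Has123 Has2341 : ∀ {n} → (Fin n → Fin n) → Set
Has123 f = ∃[ a ] ∃[ b ] (a Fin.< b × f a Fin.< f b) × ∃[ c ] b Fin.< c × f b Fin.< f c
Has2341 f =
  ∃[ a ] ∃[ b ] (a Fin.< b × f a Fin.< f b) ×
  ∃[ c ] (b Fin.< c × f b Fin.< f c) ×
  ∃[ d ] c Fin.< d × f d Fin.< f a

-- Each order condition stands right after the positions it concerns, so that it cuts off the search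
-- before the next position is chosen. The certificates below are checked by evaluating such
-- decisions.
has123? : ∀ {n} (f : Fin n → Fin n) → Dec (Has123 f)
has123? f =
  any? λ a → any? λ b → (a Fin.<? b ×-dec f a Fin.<? f b) ×-dec
  any? λ c → b Fin.<? c ×-dec f b Fin.<? f c

has2341? : ∀ {n} (f : Fin n → Fin n) → Dec (Has2341 f)
has2341? f =
  any? λ a → any? λ b → (a Fin.<? b ×-dec f a Fin.<? f b) ×-dec
  any? λ c → (b Fin.<? c ×-dec f b Fin.<? f c) ×-dec
  any? λ d → c Fin.<? d ×-dec f d Fin.<? f a

-- Diagrams, boxes and certificates

-- The names 0, …, m stand for increasing coordinates; 0 and m are sentinels, fixed points added
-- on both sides of the permutation.  Gap g lies between the names g and g + 1.
Diagram : ℕ → Set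
Diagram m = Vec (Fin (suc m)) (suc m)

-- The number g + 1 is neither 0 nor the last name, so the sentinels stay at the two ends.
newName : Fin m → Fin (suc (suc m))
newName g = suc (inject₁ g)

insertFixed : Fin m → Diagram m → Diagram (suc m)
insertFixed g τ = insertAt (Vec.map (punchIn (newName g)) τ) (newName g) (newName g)

-- An entry in gap g and its mirror image in gap h ≥ g are inserted one after the other; after
-- the first insertion the upper gap has index h + 1, also when g = h.
shift₂ : Fin m → Fin m → Fin (suc m) → Fin (suc (suc (suc m)))
shift₂ g h = punchIn (newName (suc h)) ∘ punchIn (newName g)

firstName : Fin m → Fin m → Fin (suc (suc (suc m)))
firstName g h = punchIn (newName (suc h)) (newName g)

secondName : Fin m → Fin (suc (suc (suc m)))
secondName h = newName (suc h)

-- The stored values are final names from the start; only the positions are inserted in two steps.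
insertCycle : Fin m → Fin m → Diagram m → Diagram (suc (suc m))
insertCycle g h τ =
  insertAt (insertAt (Vec.map (shift₂ g h) τ) (newName g) (secondName h)) (secondName h) (firstName g h)

Contains2341 : Diagram m → Set
Contains2341 τ = Has2341 (lookup τ)

contains2341? : (τ : Diagram m) → Dec (Contains2341 τ)
contains2341? τ = has2341? (lookup τ)

data Element (m : ℕ) : Set where
  at  : Fin (suc m) → Element m
  gap : Fin m → Element m

-- The two sides of a name are distinguished so that a box may include or exclude a drawn entry on
-- its border.
data Cut (m : ℕ) : Set where
  before after : Fin (suc m) → Cut m

mapCut : ∀ {k} → (Fin (suc m) → Fin (suc k)) → Cut m → Cut k
mapCut f (before u) = before (f u)
mapCut f (after u)  = after (f u)

infix 4 _≺_ _≺?_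

-- Points of a gap lie strictly between two names, hence both cuts at one name compare alike with a
-- gap.
_≺_ : Element m → Cut m → Set
at u  ≺ before v = u Fin.< v
at u  ≺ after v  = u Fin.≤ v
gap g ≺ before v = toℕ g < toℕ v
gap g ≺ after v  = toℕ g < toℕ v

_≺?_ : (e : Element m) (c : Cut m) → Dec (e ≺ c)
at u  ≺? before v = u Fin.<? v
at u  ≺? after v  = u Fin.≤? v
gap g ≺? before v = toℕ g ℕ.<? toℕ v
gap g ≺? after v  = toℕ g ℕ.<? toℕ v

record Box (m : ℕ) : Set where
  constructor box
  field
    left right bottom top : Cut m

open Box

mapBox : ∀ {k} → (Fin (suc m) → Fin (suc k)) → Box m → Box k
mapBox f (box l r b t) = box (mapCut f l) (mapCut f r) (mapCut f b) (mapCut f t)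

cell : Fin m → Fin m → Box m
cell g h = box (after (inject₁ g)) (before (suc g)) (after (inject₁ h)) (before (suc h))

Column Row : Box m → Element m → Set
Column B e = ¬ e ≺ left B × e ≺ right B
Row    B e = ¬ e ≺ bottom B × e ≺ top B

column? : (B : Box m) (e : Element m) → Dec (Column B e)
column? B e = ¬? (e ≺? left B) ×-dec e ≺? right B

row? : (B : Box m) (e : Element m) → Dec (Row B e)
row? B e = ¬? (e ≺? bottom B) ×-dec e ≺? top B

-- A box whose columns and rows select the same entries is an interval, so that some entry must
-- split it.
Inside Splits : Box m → Element m → Element m → Set
Inside B e f = Column B e × Row B f
Splits B e f = (Column B e × ¬ Row B f) ⊎ (¬ Column B e × Row B f)

inside? : (B : Box m) (e f : Element m) → Dec (Inside B e f)
inside? B e f = column? B e ×-dec row? B f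

splits? : (B : Box m) (e f : Element m) → Dec (Splits B e f)
splits? B e f = (column? B e ×-dec ¬? (row? B f)) ⊎-dec (¬? (column? B e) ×-dec row? B f)

record State (m : ℕ) : Set where
  constructor state
  field
    diagram   : Diagram m
    empties   : List (Box m)
    inhabited : List (Box m)

open State

-- An entry is always drawn with its mirror image, starting from the smaller coordinate. In a
-- diagonal cell it may be a fixed point or belong to a 2-cycle, so both possibilities have to
-- produce a 2341.
Unrealisable : Diagram m → Fin m → Fin m → Set
Unrealisable τ g h =
  (g Fin.< h × Contains2341 (insertCycle g h τ)) ⊎
  (h Fin.< g × Contains2341 (insertCycle h g τ)) ⊎
  (g ≡ h × Contains2341 (insertFixed g τ) × Contains2341 (insertCycle g g τ))

-- In an involution a cell is empty if and only if its mirror image is, so an empty box covering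
-- either of the two suffices.
Forbidden : State m → Fin m → Fin m → Set
Forbidden S g h =
  Any (λ B → Inside B (gap g) (gap h) ⊎ Inside B (gap h) (gap g)) (empties S) ⊎
  Unrealisable (diagram S) g h

forbidden? : (S : State m) (g h : Fin m) → Dec (Forbidden S g h)
forbidden? S g h =
  Any.any? (λ B → inside? B (gap g) (gap h) ⊎-dec inside? B (gap h) (gap g)) (empties S) ⊎-dec
  ((g Fin.<? h ×-dec contains2341? (insertCycle g h τ)) ⊎-dec
  (h Fin.<? g ×-dec contains2341? (insertCycle h g τ)) ⊎-dec
  (g Fin.≟ h ×-dec contains2341? (insertFixed g τ) ×-dec contains2341? (insertCycle g g τ)))
  where τ = diagram S

-- `R` relates the column of an entry to its row. Mixed pairs of a name and a gap need no check: the
-- drawn coordinates are closed under the involution.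
Avoided : State m → (Element m → Element m → Set) → Set
Avoided S R =
  (∀ u → ¬ R (at u) (at (lookup (diagram S) u))) ×
  (∀ g h → R (gap g) (gap h) → Forbidden S g h)

avoided? : (S : State m) {R : Element m → Element m → Set} →
           (∀ e f → Dec (R e f)) → Dec (Avoided S R)
avoided? S R? =
  all? (λ u → ¬? (R? (at u) (at (lookup (diagram S) u)))) ×-dec
  all? (λ g → all? λ h → R? (gap g) (gap h) →-dec forbidden? S g h)

-- Two drawn columns inside make the interval larger than a point, and a drawn column outside other
-- than a sentinel makes it proper. Columns are enough because, in an unsplit box, the rows select
-- the same entries.
Nontrivial : Box m → Set
Nontrivial {m} B =
  ¬ Column B (at zero) × ¬ Column B (at (fromℕ m)) ×
  (∃[ u ] ∃[ v ] u Fin.< v × Column B (at u) × Column B (at v)) ×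
  (∃[ w ] zero {m} Fin.< w × w Fin.< fromℕ m × ¬ Column B (at w))

nontrivial? : (B : Box m) → Dec (Nontrivial B)
nontrivial? {m} B =
  ¬? (column? B (at zero)) ×-dec ¬? (column? B (at (fromℕ m))) ×-dec
  any? (λ u → any? λ v → u Fin.<? v ×-dec column? B (at u) ×-dec column? B (at v)) ×-dec
  any? (λ w → zero {m} Fin.<? w ×-dec w Fin.<? fromℕ m ×-dec ¬? (column? B (at w)))

-- Every entry not yet drawn satisfies this relation; if it is avoided, the diagram is the whole
-- permutation.
data GapPair {m : ℕ} : Element m → Element m → Set where
  gaps : ∀ g h → GapPair (gap g) (gap h)

gapPair? : (e f : Element m) → Dec (GapPair e f)
gapPair? (at u)  f       = no λ ()
gapPair? (gap g) (at v)  = no λ ()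
gapPair? (gap g) (gap h) = yes (gaps g h)

-- 5274163 between the two sentinels.
target : Diagram 8
target = # 0 ∷ # 5 ∷ # 2 ∷ # 7 ∷ # 4 ∷ # 1 ∷ # 6 ∷ # 3 ∷ # 8 ∷ []

addEmpty : Box m → State m → State m
addEmpty B (state τ es is) = state τ (B ∷ es) is

-- The entry added is the leftmost one of its cell, hence the new empty box.
addFixed : Fin m → State m → State (suc m)
addFixed g (state τ es is) =
  state (insertFixed g τ)
    (box (after (ι (inject₁ g))) (before (newName g)) (after (ι (inject₁ g))) (before (ι (suc g)))
      ∷ List.map (mapBox ι) es)
    (List.map (mapBox ι) is)
  where ι = punchIn (newName g)

addCycle : Fin m → Fin m → State m → State (suc (suc m))
addCycle g h (state τ es is) =
  state (insertCycle g h τ)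
    (box (after (ι (inject₁ g))) (before (firstName g h)) (after (ι (inject₁ h))) (before (ι (suc h)))
      ∷ List.map (mapBox ι) es)
    (List.map (mapBox ι) is)
  where ι = shift₂ g h

-- Case distinctions: `above` and `diagonal` ask for the leftmost entry of a cell, the last
-- subtree being the case of an empty cell.
data Certificate : ℕ → Set where
  vacant    : Certificate m
  complete  : Certificate 8
  interval  : Box m → Certificate m
  above     : (g h : Fin m) → Certificate (suc (suc m)) → Certificate m → Certificate m
  diagonal  : (g : Fin m) → Certificate (suc m) → Certificate (suc (suc m)) → Certificate m →
              Certificate m

Valid : Certificate m → State m → Set
Valid vacant             S = Any (Avoided S ∘ Inside) (inhabited S)
Valid complete           S = diagram S ≡ target × Avoided S GapPair
Valid (interval B)       S = Nontrivial B × Avoided S (Splits B)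
Valid (above g h c d)    S = g Fin.< h × Valid c (addCycle g h S) × Valid d (addEmpty (cell g h) S)
Valid (diagonal g c d e) S =
  Valid c (addFixed g S) × Valid d (addCycle g g S) × Valid e (addEmpty (cell g g) S)

valid? : (c : Certificate m) (S : State m) → Dec (Valid c S)
valid? vacant             S = Any.any? (λ B → avoided? S (inside? B)) (inhabited S)
valid? complete           S = Vec.≡-dec Fin._≟_ (diagram S) target ×-dec avoided? S gapPair?
valid? (interval B)       S = nontrivial? B ×-dec avoided? S (splits? B)
valid? (above g h c d)    S =
  g Fin.<? h ×-dec valid? c (addCycle g h S) ×-dec valid? d (addEmpty (cell g h) S)
valid? (diagonal g c d e) S =
  valid? c (addFixed g S) ×-dec valid? d (addCycle g g S) ×-dec valid? e (addEmpty (cell g g) S)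

-- Only the middle entry of the 123 is drawn; the inhabited boxes are where its ends lie.
fixedMiddle : State 2
fixedMiddle = state (# 0 ∷ # 1 ∷ # 2 ∷ []) []
  (box (after (# 0)) (before (# 1)) (after (# 0)) (before (# 1)) ∷
   box (after (# 1)) (before (# 2)) (after (# 1)) (before (# 2)) ∷ [])

excedanceMiddle : State 3
excedanceMiddle = state (# 0 ∷ # 2 ∷ # 1 ∷ # 3 ∷ []) []
  (box (after (# 0)) (before (# 1)) (after (# 0)) (before (# 2)) ∷
   box (after (# 1)) (before (# 3)) (after (# 2)) (before (# 3)) ∷ [])

-- Both certificates were found by computer search.
fixedCertificate : Certificate 2
fixedCertificate =
  -- Below and above a fixed middle, the ends of the 123 are confined to the two diagonal cells next
  -- to it.
  diagonal (# 0)
    (diagonal (# 2)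
      (above (# 1) (# 3)
        (above (# 0) (# 3)
          (above (# 1) (# 4)
            (interval (box (after (# 0)) (after (# 2)) (before (# 6)) (after (# 7))))
            (above (# 3) (# 4)
              (interval (box (before (# 4)) (after (# 5)) (before (# 5)) (after (# 6))))
              (above (# 3) (# 6)
                (interval (box (after (# 2)) (after (# 4)) (before (# 8)) (after (# 9))))
                (diagonal (# 7)
                  (interval (box (after (# 0)) (after (# 7)) (before (# 1)) (after (# 7))))
                  (interval (box (after (# 0)) (after (# 7)) (before (# 1)) (after (# 7))))
                  -- Three fixed points and two 2-cycles are drawn here, which make up 5274163.
                  complete))))
          (interval (box (after (# 1)) (before (# 6)) (after (# 1)) (before (# 6)))))
        (interval (box (after (# 0)) (before (# 3)) (after (# 0)) (before (# 3)))))
      (above (# 0) (# 2)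
        (above (# 2) (# 6)
          (interval (box (after (# 5)) (after (# 7)) (before (# 6)) (after (# 7))))
          (interval (box (after (# 0)) (before (# 5)) (before (# 1)) (before (# 5)))))
        (interval (box (after (# 1)) (before (# 5)) (after (# 1)) (before (# 5)))))
      vacant)
    (above (# 1) (# 2)
      (interval (box (after (# 0)) (after (# 4)) (before (# 1)) (after (# 4))))
      (above (# 1) (# 3)
        (diagonal (# 5)
          (interval (box (after (# 0)) (before (# 6)) (after (# 0)) (before (# 6))))
          (interval (box (after (# 0)) (before (# 6)) (after (# 0)) (before (# 6))))
          vacant)
        (interval (box (before (# 1)) (after (# 2)) (before (# 1)) (after (# 2))))))
    vacant

excedanceCertificate : Certificate 3
excedanceCertificate =
  above (# 0) (# 1)
    -- An entry of the cell left of this one, in the same row, would be the 4 of a 2341 whose 2 is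
    -- the entry just drawn, whose 3 is the middle and whose 1 is the mirror image of the middle.
    -- The upper end is thus confined to the diagonal cell, and all that precedes the first entry
    -- there is an interval.
    (diagonal (# 4)
      (interval (box (after (# 0)) (before (# 5)) (after (# 0)) (before (# 5))))
      (interval (box (after (# 0)) (before (# 5)) (after (# 0)) (before (# 5))))
      vacant)
    (diagonal (# 0)
      (above (# 2) (# 3)
        (interval (box (after (# 1)) (before (# 6)) (after (# 1)) (before (# 6))))
        (interval (box (before (# 2)) (after (# 3)) (before (# 2)) (after (# 3)))))
      (above (# 3) (# 4)
        (above (# 1) (# 2)
          (interval (box (after (# 0)) (after (# 4)) (before (# 1)) (after (# 4))))
          (interval (box (after (# 0)) (after (# 2)) (before (# 1)) (after (# 2)))))
        (interval (box (before (# 3)) (after (# 4)) (before (# 3)) (after (# 4)))))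
      vacant)

-- The field `valid` is the unit type once `valid?` evaluates to `yes`, so the two values below are
-- proofs by computation.
record Certified (S : State m) : Set where
  constructor certify
  field
    certificate : Certificate m
    valid       : True (valid? certificate S)

fixedMiddle-certified : Certified fixedMiddle
fixedMiddle-certified = certify fixedCertificate tt

excedanceMiddle-certified : Certified excedanceMiddle
excedanceMiddle-certified = certify excedanceCertificate tt

-- Increasing coordinates

Increasing : Vec ℕ (suc m) → Set
Increasing s = ∀ g → lookup s (inject₁ g) < lookup s (suc g)

InGap : Vec ℕ (suc m) → Fin m → ℕ → Set
InGap s g x = lookup s (inject₁ g) < x × x < lookup s (suc g)

tail-increasing : ∀ {a} {s : Vec ℕ (suc m)} → Increasing (a ∷ s) → Increasing s
tail-increasing inc g = inc (suc g)

lookup-mono-< : (s : Vec ℕ (suc m)) → Increasing s → ∀ {u v} → u Fin.< v → lookup s u < lookup s v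
lookup-mono-< (a ∷ b ∷ s) inc {zero}  {suc zero}    _   = inc zero
lookup-mono-< (a ∷ b ∷ s) inc {zero}  {suc (suc v)} _   =
  <-trans (inc zero) (lookup-mono-< (b ∷ s) (tail-increasing inc) (s≤s z≤n))
lookup-mono-< (a ∷ b ∷ s) inc {suc u} {suc v} u<v = lookup-mono-< (b ∷ s) (tail-increasing inc) (s≤s⁻¹ u<v)

lookup-mono-≤ : (s : Vec ℕ (suc m)) → Increasing s → ∀ {u v} → u Fin.≤ v → lookup s u ≤ lookup s v
lookup-mono-≤ s inc {u} {v} u≤v with Fin.<-cmp u v
... | tri< u<v _ _ = <⇒≤ (lookup-mono-< s inc u<v)
... | tri≈ _ refl _ = ≤-refl
... | tri> _ _ v<u = contradiction u≤v (<⇒≱ v<u)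

lookup-cancel-< : (s : Vec ℕ (suc m)) → Increasing s → ∀ {u v} → lookup s u < lookup s v → u Fin.< v
lookup-cancel-< s inc su<sv = ≰⇒> λ v≤u → <⇒≱ su<sv (lookup-mono-≤ s inc v≤u)

insertGap : Vec ℕ (suc m) → Fin m → ℕ → Vec ℕ (suc (suc m))
insertGap s g x = insertAt s (newName g) x

insertGap-increasing : (s : Vec ℕ (suc m)) (g : Fin m) {x : ℕ} → Increasing s → InGap s g x →
                       Increasing (insertGap s g x)
insertGap-increasing (a ∷ b ∷ s) zero    inc (a<x , x<b) zero          = a<x
insertGap-increasing (a ∷ b ∷ s) zero    inc (a<x , x<b) (suc zero)    = x<b
insertGap-increasing (a ∷ b ∷ s) zero    inc (a<x , x<b) (suc (suc h)) = inc (suc h)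
insertGap-increasing (a ∷ b ∷ s) (suc g) inc a<x<b       zero          = inc zero
insertGap-increasing (a ∷ b ∷ s) (suc g) inc a<x<b       (suc h)       =
  insertGap-increasing (b ∷ s) g (tail-increasing inc) a<x<b h

-- Prepares the insertion of the mirror image: if `g` equals `h`, the lower end of the shifted gap
-- is the new point `x` itself, whence the hypothesis `x < y`.
insertGap-lower : (s : Vec ℕ (suc m)) {g h : Fin m} {x y : ℕ} → g Fin.≤ h → x < y →
                  lookup s (inject₁ h) < y → lookup (insertGap s g x) (inject₁ (suc h)) < y
insertGap-lower (a ∷ b ∷ s) {zero}  {zero}  _   x<y _   = x<y
insertGap-lower (a ∷ b ∷ s) {zero}  {suc h} _   _   l<y = l<y
insertGap-lower (a ∷ b ∷ s) {suc g} {suc h} g≤h x<y l<y = insertGap-lower (b ∷ s) (s≤s⁻¹ g≤h) x<y l<y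

insertGap-upper : (s : Vec ℕ (suc m)) {g h : Fin m} {x : ℕ} → g Fin.≤ h →
                  lookup (insertGap s g x) (suc (suc h)) ≡ lookup s (suc h)
insertGap-upper (a ∷ b ∷ s) {zero}  {zero}  _   = refl
insertGap-upper (a ∷ b ∷ s) {zero}  {suc h} _   = refl
insertGap-upper (a ∷ b ∷ s) {suc g} {suc h} g≤h = insertGap-upper (b ∷ s) (s≤s⁻¹ g≤h)

insertGap-zero : (s : Vec ℕ (suc m)) (g : Fin m) {x : ℕ} → lookup (insertGap s g x) zero ≡ lookup s zero
insertGap-zero (a ∷ s) g = refl

insertGap-last : (s : Vec ℕ (suc m)) (g : Fin m) {x : ℕ} →
                 lookup (insertGap s g x) (fromℕ (suc m)) ≡ lookup s (fromℕ m)
insertGap-last (a ∷ b ∷ s) zero    = refl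
insertGap-last (a ∷ b ∷ s) (suc g) = insertGap-last (b ∷ s) g

data Located (s : Vec ℕ (suc m)) (x : ℕ) : Element m → Set where
  located-at  : ∀ {u} → x ≡ lookup s u → Located s x (at u)
  located-gap : ∀ {g} → InGap s g x → Located s x (gap g)

locate : (s : Vec ℕ (suc m)) {x : ℕ} → lookup s zero ≤ x → x ≤ lookup s (fromℕ m) →
         ∃[ e ] Located s x e
locate (a ∷ []) a≤x x≤a = at zero , located-at (≤-antisym x≤a a≤x)
locate (a ∷ b ∷ s) {x} a≤x x≤l with m≤n⇒m<n∨m≡n a≤x | x ℕ.<? b
... | inj₂ refl | _       = at zero , located-at refl
... | inj₁ a<x  | yes x<b = gap zero , located-gap (a<x , x<b)
... | inj₁ a<x  | no  x≮b with locate (b ∷ s) (≮⇒≥ x≮b) x≤l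
... | _ , located-at {u} x≡  = at (suc u) , located-at x≡
... | _ , located-gap {g} x∈ = gap (suc g) , located-gap x∈

-- With the successor for `after`, every cut becomes a bound of a half-open range, and lying before
-- a cut becomes a strict inequality.
cutValue : Vec ℕ (suc m) → Cut m → ℕ
cutValue s (before v) = lookup s v
cutValue s (after v)  = suc (lookup s v)

≺-sound : (s : Vec ℕ (suc m)) → Increasing s → ∀ {x e c} → Located s x e → e ≺ c → x < cutValue s c
≺-sound s inc {c = before v} (located-at refl)      u<v = lookup-mono-< s inc u<v
≺-sound s inc {c = after v}  (located-at refl)      u≤v = s≤s (lookup-mono-≤ s inc u≤v)
≺-sound s inc {c = before v} (located-gap (_ , x<)) g<v = <-≤-trans x< (lookup-mono-≤ s inc g<v)
≺-sound s inc {c = after v}  (located-gap (_ , x<)) g<v = m<n⇒m<1+n (<-≤-trans x< (lookup-mono-≤ s inc g<v))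

≺-complete : (s : Vec ℕ (suc m)) → Increasing s → ∀ {x e c} → Located s x e → x < cutValue s c → e ≺ c
≺-complete s inc {x} {e} {c} x∈e x<c with e ≺? c
... | yes e≺c = e≺c
... | no  e⊀c = contradiction x<c (≤⇒≯ (bound x∈e e⊀c))
  where
  ≮⇒≤inject₁ : ∀ v g → ¬ toℕ g < toℕ v → v Fin.≤ inject₁ g
  ≮⇒≤inject₁ v g g≮v = subst (toℕ v ≤_) (sym (Fin.toℕ-inject₁ g)) (≮⇒≥ g≮v)

  bound : ∀ {x e c} → Located s x e → ¬ e ≺ c → cutValue s c ≤ x
  bound {c = before v} (located-at refl) u≮v = lookup-mono-≤ s inc (≮⇒≥ u≮v)
  bound {c = after v}  (located-at refl) u≰v = lookup-mono-< s inc (≰⇒> u≰v)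
  bound {c = before v} (located-gap {g} (l<x , _)) g≮v =
    <⇒≤ (≤-<-trans (lookup-mono-≤ s inc (≮⇒≤inject₁ v g g≮v)) l<x)
  bound {c = after v}  (located-gap {g} (l<x , _)) g≮v =
    ≤-<-trans (lookup-mono-≤ s inc (≮⇒≤inject₁ v g g≮v)) l<x

-- Supplies the leftmost entry of a cell, or the emptiness of the cell.
leastBelow : {Q : ℕ → Set} → (∀ x → Dec (Q x)) → ∀ k →
             (∃[ x ] Q x × (∀ {y} → y < x → ¬ Q y)) ⊎ (∀ {y} → y < k → ¬ Q y)
leastBelow Q? zero = inj₂ λ ()
leastBelow Q? (suc k) with leastBelow Q? k | Q? k
... | inj₁ least | _      = inj₁ least
... | inj₂ none  | yes q  = inj₁ (k , q , none)
... | inj₂ none  | no ¬q  = inj₂ λ y<1+k → case m≤n⇒m<n∨m≡n (s≤s⁻¹ y<1+k) of λ where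
  (inj₁ y<k)  → none y<k
  (inj₂ refl) → ¬q

-- Separates the name created by an insertion from the renamed old ones.
punchIn-elim : ∀ {k} (i : Fin (suc k)) {Q : Fin (suc k) → Set} →
               Q i → (∀ v → Q (punchIn i v)) → ∀ u → Q u
punchIn-elim i {Q} qi q u with i Fin.≟ u
... | yes refl = qi
... | no i≢u   = subst Q (Fin.punchIn-punchOut i≢u) (q (Fin.punchOut i≢u))

consecutive⇒lookup≡ : (s : Vec ℕ (suc m)) → (∀ g → lookup s (suc g) ≡ suc (lookup s (inject₁ g))) →
                      ∀ u → lookup s u ≡ lookup s zero + toℕ u
consecutive⇒lookup≡ (a ∷ s)     next zero    = sym (+-identityʳ a)
consecutive⇒lookup≡ (a ∷ b ∷ s) next (suc u) =
  trans (consecutive⇒lookup≡ (b ∷ s) (next ∘ suc) u)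
        (trans (cong (_+ toℕ u) (next zero)) (sym (+-suc a (toℕ u))))

-- Soundness of certificates

-- P is π shifted to the coordinates 1, …, n, with the sentinels 0 and n + 1 as further fixed points.
record ExtendedSimple (n : ℕ) (P : ℕ → ℕ) : Set where
  field
    involutive : ∀ x → P (P x) ≡ x
    fixes-zero : P 0 ≡ 0
    fixes-last : P (suc n) ≡ suc n
    bounded    : ∀ {x} → x ≤ suc n → P x ≤ suc n
    avoids     : ∀ {a b c d} → a < b → b < c → c < d → d ≤ suc n →
                 P a < P b → P b < P c → ¬ P d < P a
    simple     : ∀ {l r b t} →
                 (∀ {x} → x ≤ suc n → l ≤ x → x < r → b ≤ P x × P x < t) →
                 (∀ {x} → x ≤ suc n → b ≤ P x → P x < t → l ≤ x × x < r) →
                 1 ≤ l → r ≤ suc n → 1 ≤ b → t ≤ suc n → suc l < r → l ≤ 1 × suc n ≤ r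

module Soundness (n : ℕ) (P : ℕ → ℕ) (ext : ExtendedSimple n P) where
  open ExtendedSimple ext
  open ≡-Reasoning

  -- The vector `s` gives the actual coordinates of the names; by `commutes` they are closed under
  -- `P`.
  record Embedding (s : Vec ℕ (suc m)) (τ : Diagram m) : Set where
    field
      increasing : Increasing s
      zero↦0     : lookup s zero ≡ 0
      last↦1+n   : lookup s (fromℕ m) ≡ suc n
      commutes   : ∀ u → P (lookup s u) ≡ lookup s (lookup τ u)

    lookup≤1+n : ∀ u → lookup s u ≤ suc n
    lookup≤1+n u = subst (lookup s u ≤_) last↦1+n
      (lookup-mono-≤ s increasing (subst (toℕ u ≤_) (sym (Fin.toℕ-fromℕ m)) (Fin.toℕ≤pred[n] u)))

  open Embedding

  InColumn InRow InBox : Vec ℕ (suc m) → Box m → ℕ → Set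
  InColumn s B x = cutValue s (left B) ≤ x × x < cutValue s (right B)
  InRow    s B x = cutValue s (bottom B) ≤ P x × P x < cutValue s (top B)
  InBox    s B x = InColumn s B x × InRow s B x

  Empty Occupied : Vec ℕ (suc m) → Box m → Set
  Empty    s B = ∀ x → x ≤ suc n → ¬ InBox s B x
  Occupied s B = ∃[ x ] x ≤ suc n × InBox s B x

  record Model (s : Vec ℕ (suc m)) (S : State m) : Set where
    field
      embedding : Embedding s (diagram S)
      isEmpty   : All (Empty s) (empties S)
      hasPoint  : All (Occupied s) (inhabited S)

  open Model

  cyclePoints : Vec ℕ (suc m) → Fin m → Fin m → ℕ → Vec ℕ (3 + m)
  cyclePoints s g h x = insertGap (insertGap s g x) (suc h) (P x)

  module _ (s : Vec ℕ (suc m)) where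
    fixedPoints-old : ∀ g x u → lookup (insertGap s g x) (punchIn (newName g) u) ≡ lookup s u
    fixedPoints-old g = insertAt-punchIn s (newName g)

    fixedPoints-new : ∀ g x → lookup (insertGap s g x) (newName g) ≡ x
    fixedPoints-new g = insertAt-lookup s (newName g)

    cyclePoints-old : ∀ g h x u → lookup (cyclePoints s g h x) (shift₂ g h u) ≡ lookup s u
    cyclePoints-old g h x u =
      trans (insertAt-punchIn (insertGap s g x) (secondName h) (P x) (punchIn (newName g) u))
            (insertAt-punchIn s (newName g) x u)

    cyclePoints-first : ∀ g h x → lookup (cyclePoints s g h x) (firstName g h) ≡ x
    cyclePoints-first g h x =
      trans (insertAt-punchIn (insertGap s g x) (secondName h) (P x) (newName g)) (insertAt-lookup s (newName g) x)

    cyclePoints-second : ∀ g h x → lookup (cyclePoints s g h x) (secondName h) ≡ P x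
    cyclePoints-second g h x = insertAt-lookup (insertGap s g x) (secondName h) (P x)

  data Classified (s : Vec ℕ (suc m)) (τ : Diagram m) (x : ℕ) : Element m → Element m → Set where
    named : ∀ {u} → x ≡ lookup s u → Classified s τ x (at u) (at (lookup τ u))
    new   : ∀ {g h} → InGap s g x → InGap s h (P x) → Classified s τ x (gap g) (gap h)

  module _ {s : Vec ℕ (suc m)} {τ : Diagram m} (emb : Embedding s τ) where
    private
      inc = increasing emb

    locate≤ : ∀ {x} → x ≤ suc n → ∃[ e ] Located s x e
    locate≤ {x} x≤ = locate s (subst (_≤ x) (sym (zero↦0 emb)) z≤n) (subst (x ≤_) (sym (last↦1+n emb)) x≤)

    locatedAt⇒¬inGap : ∀ {x u g} → x ≡ lookup s u → ¬ InGap s g x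
    locatedAt⇒¬inGap {u = u} {g} x≡ (l<x , x<r) =
      <⇒≱ (≺-complete s inc {c = before (suc g)} (located-at x≡) x<r)
        (≰⇒> λ u≤g → <⇒≱ (≺-sound s inc {c = after (inject₁ g)} (located-at x≡)
          (subst (toℕ u ≤_) (sym (Fin.toℕ-inject₁ g)) u≤g)) l<x)

    classify : ∀ {x} → x ≤ suc n → ∃[ e ] ∃[ f ] Classified s τ x e f
    classify {x} x≤ with locate≤ x≤ | locate≤ (bounded x≤)
    ... | _ , located-at x≡  | _ = _ , _ , named x≡
    ... | _ , located-gap x∈ | _ , located-gap Px∈ = _ , _ , new x∈ Px∈
    -- If `P x` has a name, so has its image `x`.
    ... | _ , located-gap x∈ | _ , located-at Px≡ =
      contradiction x∈ (locatedAt⇒¬inGap (trans (sym (involutive x)) (trans (cong P Px≡) (commutes emb _))))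

    position : ∀ {x e f} → Classified s τ x e f → Located s x e
    position (named x≡) = located-at x≡
    position (new x∈ _) = located-gap x∈

    value : ∀ {x e f} → Classified s τ x e f → Located s (P x) f
    value (named refl)  = located-at (commutes emb _)
    value (new _ Px∈) = located-gap Px∈

    column-sound : ∀ B {x e} → Located s x e → Column B e → InColumn s B x
    column-sound B x∈e (e⊀l , e≺r) = ≮⇒≥ (e⊀l ∘ ≺-complete s inc x∈e) , ≺-sound s inc x∈e e≺r

    row-sound : ∀ B {x f} → Located s (P x) f → Row B f → InRow s B x
    row-sound B Px∈f (f⊀b , f≺t) = ≮⇒≥ (f⊀b ∘ ≺-complete s inc Px∈f) , ≺-sound s inc Px∈f f≺t

    column-complete : ∀ B {x e} → Located s x e → InColumn s B x → Column B e
    column-complete B x∈e (l≤x , x<r) =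
      (λ e≺l → <⇒≱ (≺-sound s inc x∈e e≺l) l≤x) , ≺-complete s inc {c = right B} x∈e x<r

    row-complete : ∀ B {x f} → Located s (P x) f → InRow s B x → Row B f
    row-complete B Px∈f (b≤Px , Px<t) =
      (λ f≺b → <⇒≱ (≺-sound s inc Px∈f f≺b) b≤Px) , ≺-complete s inc {c = top B} Px∈f Px<t

    ¬contains2341 : ¬ Contains2341 τ
    ¬contains2341 (a , b , (a<b , τa<τb) , c , (b<c , τb<τc) , d , c<d , τd<τa) =
      avoids (mono a<b) (mono b<c) (mono c<d) (lookup≤1+n emb d) (value-mono a b τa<τb) (value-mono b c τb<τc)
        (value-mono d a τd<τa)
      where
      mono : ∀ {u v} → u Fin.< v → lookup s u < lookup s v
      mono = lookup-mono-< s inc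
      value-mono : ∀ u v → lookup τ u Fin.< lookup τ v → P (lookup s u) < P (lookup s v)
      value-mono u v τu<τv = subst₂ _<_ (sym (commutes emb u)) (sym (commutes emb v)) (mono τu<τv)

    gap-mono-< : ∀ {g h x y} → g Fin.< h → InGap s g x → InGap s h y → x < y
    gap-mono-< {g} {h} g<h (_ , x<) (<y , _) =
      <-trans x< (≤-<-trans (lookup-mono-≤ s inc (subst (suc (toℕ g) ≤_) (sym (Fin.toℕ-inject₁ h)) g<h)) <y)

    insertCycle-embedding : ∀ {g h x} → g Fin.≤ h → InGap s g x → InGap s h (P x) → x < P x →
                            Embedding (cyclePoints s g h x) (insertCycle g h τ)
    insertCycle-embedding {g} {h} {x} g≤h x∈ Px∈ x<Px = record
      { increasing = insertGap-increasing (insertGap s g x) (suc h) (insertGap-increasing s g inc x∈)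
          ( insertGap-lower s g≤h x<Px (proj₁ Px∈)
          , subst (P x <_) (sym (insertGap-upper s g≤h)) (proj₂ Px∈))
      ; zero↦0   = trans (insertGap-zero (insertGap s g x) (suc h)) (trans (insertGap-zero s g) (zero↦0 emb))
      ; last↦1+n = trans (insertGap-last (insertGap s g x) (suc h)) (trans (insertGap-last s g) (last↦1+n emb))
      ; commutes = punchIn-elim (secondName h) second (punchIn-elim (newName g) first old)
      }
      where
      s″ = cyclePoints s g h x
      τ₀ = Vec.map (shift₂ g h) τ
      τ₁ = insertAt τ₀ (newName g) (secondName h)

      Commutes : Fin (3 + m) → Set
      Commutes u = P (lookup s″ u) ≡ lookup s″ (lookup (insertCycle g h τ) u)

      partner : ∀ u → lookup (insertCycle g h τ) (punchIn (secondName h) u) ≡ lookup τ₁ u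
      partner = insertAt-punchIn τ₁ (secondName h) (firstName g h)

      second : Commutes (secondName h)
      second = begin
        P (lookup s″ (secondName h)) ≡⟨ cong P (cyclePoints-second s g h x) ⟩
        P (P x)                      ≡⟨ involutive x ⟩
        x                            ≡⟨ cyclePoints-first s g h x ⟨
        lookup s″ (firstName g h)    ≡⟨ cong (lookup s″) (insertAt-lookup τ₁ (secondName h) (firstName g h)) ⟨
        lookup s″ (lookup (insertCycle g h τ) (secondName h)) ∎

      first : Commutes (firstName g h)
      first = begin
        P (lookup s″ (firstName g h))     ≡⟨ cong P (cyclePoints-first s g h x) ⟩
        P x                               ≡⟨ cyclePoints-second s g h x ⟨
        lookup s″ (secondName h)          ≡⟨ cong (lookup s″) (insertAt-lookup τ₀ (newName g) (secondName h)) ⟨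
        lookup s″ (lookup τ₁ (newName g)) ≡⟨ cong (lookup s″) (partner (newName g)) ⟨
        lookup s″ (lookup (insertCycle g h τ) (firstName g h)) ∎

      old : ∀ u → Commutes (shift₂ g h u)
      old u = begin
        P (lookup s″ (shift₂ g h u))          ≡⟨ cong P (cyclePoints-old s g h x u) ⟩
        P (lookup s u)                        ≡⟨ commutes emb u ⟩
        lookup s (lookup τ u)                 ≡⟨ cyclePoints-old s g h x (lookup τ u) ⟨
        lookup s″ (shift₂ g h (lookup τ u))   ≡⟨ cong (lookup s″) (lookup-map u (shift₂ g h) τ) ⟨
        lookup s″ (lookup τ₀ u)               ≡⟨ cong (lookup s″) (insertAt-punchIn τ₀ (newName g) (secondName h) u) ⟨
        lookup s″ (lookup τ₁ (punchIn (newName g) u)) ≡⟨ cong (lookup s″) (partner (punchIn (newName g) u)) ⟨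
        lookup s″ (lookup (insertCycle g h τ) (shift₂ g h u)) ∎

    insertFixed-embedding : ∀ {g x} → InGap s g x → P x ≡ x → Embedding (insertGap s g x) (insertFixed g τ)
    insertFixed-embedding {g} {x} x∈ Px≡x = record
      { increasing = insertGap-increasing s g inc x∈
      ; zero↦0     = trans (insertGap-zero s g) (zero↦0 emb)
      ; last↦1+n   = trans (insertGap-last s g) (last↦1+n emb)
      ; commutes   = punchIn-elim k fixed old
      }
      where
      k  = newName g
      s′ = insertGap s g x
      τ₀ = Vec.map (punchIn k) τ

      Commutes : Fin (2 + m) → Set
      Commutes u = P (lookup s′ u) ≡ lookup s′ (lookup (insertFixed g τ) u)

      fixed : Commutes k
      fixed = begin
        P (lookup s′ k) ≡⟨ cong P (fixedPoints-new s g x) ⟩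
        P x             ≡⟨ Px≡x ⟩
        x               ≡⟨ fixedPoints-new s g x ⟨
        lookup s′ k     ≡⟨ cong (lookup s′) (insertAt-lookup τ₀ k k) ⟨
        lookup s′ (lookup (insertFixed g τ) k) ∎

      old : ∀ u → Commutes (punchIn k u)
      old u = begin
        P (lookup s′ (punchIn k u))        ≡⟨ cong P (fixedPoints-old s g x u) ⟩
        P (lookup s u)                     ≡⟨ commutes emb u ⟩
        lookup s (lookup τ u)              ≡⟨ fixedPoints-old s g x (lookup τ u) ⟨
        lookup s′ (punchIn k (lookup τ u)) ≡⟨ cong (lookup s′) (lookup-map u (punchIn k) τ) ⟨
        lookup s′ (lookup τ₀ u)            ≡⟨ cong (lookup s′) (insertAt-punchIn τ₀ k k u) ⟨
        lookup s′ (lookup (insertFixed g τ) (punchIn k u)) ∎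

  unrealisable-sound : ∀ {s : Vec ℕ (suc m)} {τ g h x} → Embedding s τ →
                       InGap s g x → InGap s h (P x) → ¬ Unrealisable τ g h
  unrealisable-sound emb x∈ Px∈ (inj₁ (g<h , bad)) =
    ¬contains2341 (insertCycle-embedding emb (<⇒≤ g<h) x∈ Px∈ (gap-mono-< emb g<h x∈ Px∈)) bad
  -- Here the excedance of the 2-cycle is at `P x`, with image `x`.
  unrealisable-sound {s = s} {g = g} {x = x} emb x∈ Px∈ (inj₂ (inj₁ (h<g , bad))) =
    ¬contains2341 (insertCycle-embedding emb (<⇒≤ h<g) Px∈ PPx∈ (gap-mono-< emb h<g Px∈ PPx∈)) bad
    where PPx∈ = subst (InGap s g) (sym (involutive x)) x∈
  unrealisable-sound {s = s} {g = g} {x = x} emb x∈ Px∈ (inj₂ (inj₂ (refl , bad-fixed , bad-cycle)))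
    with <-cmp x (P x)
  ... | tri< x<Px _ _ = ¬contains2341 (insertCycle-embedding emb ≤-refl x∈ Px∈ x<Px) bad-cycle
  ... | tri≈ _ x≡Px _ = ¬contains2341 (insertFixed-embedding emb x∈ (sym x≡Px)) bad-fixed
  ... | tri> _ _ Px<x = ¬contains2341 (insertCycle-embedding emb ≤-refl Px∈ PPx∈ Px<PPx) bad-cycle
    where
    PPx∈  = subst (InGap s g) (sym (involutive x)) x∈
    Px<PPx = subst (P x <_) (sym (involutive x)) Px<x

  module _ {s : Vec ℕ (suc m)} {S : State m} (M : Model s S) where
    private
      emb = embedding M

    inside-sound : ∀ B {x e f} → Located s x e → Located s (P x) f → Inside B e f → InBox s B x
    inside-sound B x∈e Px∈f (col , row) = column-sound emb B x∈e col , row-sound emb B Px∈f row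

    inGap⇒≤1+n : ∀ {g x} → InGap s g x → x ≤ suc n
    inGap⇒≤1+n {g} (_ , x<) = ≤-trans (<⇒≤ x<) (lookup≤1+n emb (suc g))

    forbidden-sound : ∀ {g h x} → InGap s g x → InGap s h (P x) → ¬ Forbidden S g h
    forbidden-sound x∈ Px∈ (inj₂ bad) = unrealisable-sound emb x∈ Px∈ bad
    forbidden-sound {g} {h} {x} x∈ Px∈ (inj₁ excluded) = refute (isEmpty M) excluded
      where
      refute : ∀ {Bs} → All (Empty s) Bs →
               ¬ Any (λ B → Inside B (gap g) (gap h) ⊎ Inside B (gap h) (gap g)) Bs
      refute (empty ∷ _) (Any.here (inj₁ inside)) =
        empty _ (inGap⇒≤1+n x∈) (inside-sound _ (located-gap x∈) (located-gap Px∈) inside)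
      -- The mirrored cell is covered, so the entry at `P x` contradicts emptiness.
      refute (empty ∷ _) (Any.here (inj₂ inside)) =
        empty _ (inGap⇒≤1+n Px∈) (inside-sound _ (located-gap Px∈)
          (located-gap (subst (InGap s g) (sym (involutive x)) x∈)) inside)
      refute (_ ∷ empty) (Any.there excluded′) = refute empty excluded′

    -- Turns the finite check over names and cells into a statement on every coordinate up to n + 1.
    avoided-sound : ∀ {R x} → Avoided S R → x ≤ suc n →
                    ∃[ e ] ∃[ f ] Classified s (diagram S) x e f × ¬ R e f
    avoided-sound (names , gaps′) x≤ with classify emb x≤
    ... | _ , _ , c@(named _)    = _ , _ , c , names _
    ... | _ , _ , c@(new x∈ Px∈) = _ , _ , c , λ r → forbidden-sound x∈ Px∈ (gaps′ _ _ r)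

    vacant-sound : ¬ Any (Avoided S ∘ Inside) (inhabited S)
    vacant-sound = refute (hasPoint M)
      where
      refute : ∀ {Bs} → All (Occupied s) Bs → ¬ Any (Avoided S ∘ Inside) Bs
      refute {B ∷ _} ((x , x≤ , col , row) ∷ _) (Any.here avoided) with avoided-sound {Inside B} avoided x≤
      ... | _ , _ , c , ¬inside = ¬inside
        (column-complete emb B (position emb c) col , row-complete emb B (value emb c) row)
      refute (_ ∷ points) (Any.there avoided) = refute points avoided

    -- As no entry splits the box, its columns and rows bound an interval. It misses the sentinels,
    -- contains `u` and `v` and omits `w`, contrary to simplicity.
    interval-sound : ∀ B → Nontrivial B → ¬ Avoided S (Splits B)
    interval-sound B (0∉ , last∉ , (u , v , u<v , u∈ , v∈) , (w , 0<w , w<last , w∉)) avoided =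
      ¬spanning (simple column⇒row row⇒column 1≤l r≤1+n 1≤b t≤1+n (<-≤-trans (s≤s (≤-<-trans (proj₁ ⟦u⟧)
        (lookup-mono-< s inc u<v))) (proj₂ (column-sound emb B (located-at refl) v∈))))
      where
      inc = increasing emb
      l = cutValue s (left B)
      r = cutValue s (right B)
      b = cutValue s (bottom B)
      t = cutValue s (top B)

      column⇒row : ∀ {x} → x ≤ suc n → l ≤ x → x < r → b ≤ P x × P x < t
      column⇒row x≤ l≤x x<r with avoided-sound {Splits B} avoided x≤
      ... | e , f , c , ¬split with row? B f
      ... | yes row = row-sound emb B (value emb c) row
      ... | no ¬row = contradiction (inj₁ (column-complete emb B (position emb c) (l≤x , x<r) , ¬row)) ¬split

      row⇒column : ∀ {x} → x ≤ suc n → b ≤ P x → P x < t → l ≤ x × x < r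
      row⇒column x≤ b≤Px Px<t with avoided-sound {Splits B} avoided x≤
      ... | e , f , c , ¬split with column? B e
      ... | yes col = column-sound emb B (position emb c) col
      ... | no ¬col = contradiction (inj₂ (¬col , row-complete emb B (value emb c) (b≤Px , Px<t))) ¬split

      ⟦u⟧ : l ≤ lookup s u × lookup s u < r
      ⟦u⟧ = column-sound emb B (located-at refl) u∈

      u-row : b ≤ P (lookup s u) × P (lookup s u) < t
      u-row = column⇒row (lookup≤1+n emb u) (proj₁ ⟦u⟧) (proj₂ ⟦u⟧)

      0∉′ : ¬ (l ≤ 0 × 0 < r)
      0∉′ = 0∉ ∘ column-complete emb B (located-at (sym (zero↦0 emb)))

      last∉′ : ¬ (l ≤ suc n × suc n < r)
      last∉′ = last∉ ∘ column-complete emb B (located-at (sym (last↦1+n emb)))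

      -- The sentinels are fixed points, so a row range reaching one would force the column range to
      -- reach it too.
      0∉row : ¬ (b ≤ 0 × 0 < t)
      0∉row (b≤0 , 0<t) =
        0∉′ (row⇒column z≤n (subst (b ≤_) (sym fixes-zero) b≤0) (subst (_< t) (sym fixes-zero) 0<t))

      last∉row : ¬ (b ≤ suc n × suc n < t)
      last∉row (b≤ , <t) =
        last∉′ (row⇒column ≤-refl (subst (b ≤_) (sym fixes-last) b≤) (subst (_< t) (sym fixes-last) <t))

      1≤l : 1 ≤ l
      1≤l = ≰⇒> λ l≤0 → 0∉′ (l≤0 , ≤-<-trans z≤n (proj₂ ⟦u⟧))

      r≤1+n : r ≤ suc n
      r≤1+n = ≮⇒≥ λ <r → last∉′ (≤-trans (proj₁ ⟦u⟧) (lookup≤1+n emb u) , <r)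

      1≤b : 1 ≤ b
      1≤b = ≰⇒> λ b≤0 → 0∉row (b≤0 , ≤-<-trans z≤n (proj₂ u-row))

      t≤1+n : t ≤ suc n
      t≤1+n = ≮⇒≥ λ <t → last∉row (≤-trans (proj₁ u-row) (bounded (lookup≤1+n emb u)) , <t)

      ¬spanning : ¬ (l ≤ 1 × suc n ≤ r)
      ¬spanning (l≤1 , 1+n≤r) = w∉ (column-complete emb B (located-at refl)
        ( ≤-trans l≤1 (subst (_< lookup s w) (zero↦0 emb) (lookup-mono-< s inc 0<w))
        , <-≤-trans (subst (lookup s w <_) (last↦1+n emb) (lookup-mono-< s inc w<last)) 1+n≤r))

  IsTarget : Set
  IsTarget = n ≡ 7 × (∀ u → P (toℕ u) ≡ toℕ (lookup target u))

  -- With all cells empty, no coordinate is left between neighbouring names; names and coordinates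
  -- then agree, and the last name 8 is n + 1.
  complete-sound : ∀ {s S} → Model s S → diagram S ≡ target → Avoided S GapPair → IsTarget
  complete-sound {s} {S} M refl avoided =
    suc-injective (trans (sym (last↦1+n emb)) (identity (fromℕ 8))) ,
    λ u → trans (cong P (sym (identity u))) (trans (commutes emb u) (identity (lookup target u)))
    where
    emb = embedding M

    next : ∀ g → lookup s (suc g) ≡ suc (lookup s (inject₁ g))
    next g with m≤n⇒m<n∨m≡n (increasing emb g)
    ... | inj₂ eq = sym eq
    -- The number just after the lower name would lie inside the gap: it has no name, and an undrawn
    -- entry is excluded.
    ... | inj₁ lt with avoided-sound M {GapPair} avoided (≤-trans (<⇒≤ lt) (lookup≤1+n emb (suc g)))
    ... | _ , _ , named x≡ , _     = contradiction (≤-refl , lt) (locatedAt⇒¬inGap emb x≡)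
    ... | _ , _ , new x∈ Px∈ , ¬gp = contradiction (gaps _ _) ¬gp

    identity : ∀ u → lookup s u ≡ toℕ u
    identity u = trans (consecutive⇒lookup≡ s next u) (cong (_+ toℕ u) (zero↦0 emb))

  module _ {k} {s : Vec ℕ (suc m)} {s′ : Vec ℕ (suc k)} {ι : Fin (suc m) → Fin (suc k)}
           (old : ∀ u → lookup s′ (ι u) ≡ lookup s u) where

    -- Renaming leaves coordinates unchanged, so what is known about a box survives every insertion.
    cutValue-map : ∀ c → cutValue s′ (mapCut ι c) ≡ cutValue s c
    cutValue-map (before u) = old u
    cutValue-map (after u)  = cong suc (old u)

    inBox-map⁺ : ∀ {x} B → InBox s B x → InBox s′ (mapBox ι B) x
    inBox-map⁺ (box l r b t) inBox
      rewrite cutValue-map l | cutValue-map r | cutValue-map b | cutValue-map t = inBox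

    inBox-map⁻ : ∀ {x} B → InBox s′ (mapBox ι B) x → InBox s B x
    inBox-map⁻ (box l r b t) inBox
      rewrite cutValue-map l | cutValue-map r | cutValue-map b | cutValue-map t = inBox

    isEmpty-map : ∀ {Bs} → All (Empty s) Bs → All (Empty s′) (List.map (mapBox ι) Bs)
    isEmpty-map = All.map⁺ ∘ All.map (λ {B} empty x x≤ → empty x x≤ ∘ inBox-map⁻ B)

    hasPoint-map : ∀ {Bs} → All (Occupied s) Bs → All (Occupied s′) (List.map (mapBox ι) Bs)
    hasPoint-map = All.map⁺ ∘ All.map (λ {B} (x , x≤ , inBox) → x , x≤ , inBox-map⁺ B inBox)

  InCell : Vec ℕ (suc m) → Fin m → Fin m → ℕ → Set
  InCell s g h x = InGap s g x × InGap s h (P x)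

  inCell? : (s : Vec ℕ (suc m)) (g h : Fin m) → ∀ x → Dec (InCell s g h x)
  inCell? s g h x =
    (lookup s (inject₁ g) ℕ.<? x ×-dec x ℕ.<? lookup s (suc g)) ×-dec
    (lookup s (inject₁ h) ℕ.<? P x ×-dec P x ℕ.<? lookup s (suc h))

  module _ {s : Vec ℕ (suc m)} {S : State m} (M : Model s S) where
    private
      emb = embedding M

    addEmpty-model : ∀ {g h} → (∀ {x} → x < suc (suc n) → ¬ InCell s g h x) → Model s (addEmpty (cell g h) S)
    addEmpty-model none = record
      { embedding = emb
      ; isEmpty   = (λ _ x≤ → none (s≤s x≤)) ∷ isEmpty M
      ; hasPoint  = hasPoint M
      }

    module _ {g h x} (g≤h : g Fin.≤ h) (x<Px : x < P x) (x∈ : InCell s g h x)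
             (leftmost : ∀ {y} → y < x → ¬ InCell s g h y) where
      private
        s″ = cyclePoints s g h x
        old = cyclePoints-old s g h x

      addCycle-model : Model s″ (addCycle g h S)
      addCycle-model = record
        { embedding = insertCycle-embedding emb g≤h (proj₁ x∈) (proj₂ x∈) x<Px
        ; isEmpty   = (λ _ _ → none) ∷ isEmpty-map old (isEmpty M)
        ; hasPoint  = hasPoint-map old (hasPoint M)
        }
        where
        none : ∀ {y} → ¬ InBox s″ (box (after (shift₂ g h (inject₁ g))) (before (firstName g h))
                                       (after (shift₂ g h (inject₁ h))) (before (shift₂ g h (suc h)))) y
        none {y} inBox
          rewrite old (inject₁ g) | old (inject₁ h) | old (suc h) | cyclePoints-first s g h x
          with ((l<y , y<x) , row) ← inBox = leftmost y<x ((l<y , <-trans y<x (proj₂ (proj₁ x∈))) , row)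

    module _ {g x} (Px≡x : P x ≡ x) (x∈ : InCell s g g x)
             (leftmost : ∀ {y} → y < x → ¬ InCell s g g y) where
      private
        s′ = insertGap s g x
        old = fixedPoints-old s g x
        ι = punchIn (newName g)

      addFixed-model : Model s′ (addFixed g S)
      addFixed-model = record
        { embedding = insertFixed-embedding emb (proj₁ x∈) Px≡x
        ; isEmpty   = (λ _ _ → none) ∷ isEmpty-map old (isEmpty M)
        ; hasPoint  = hasPoint-map old (hasPoint M)
        }
        where
        none : ∀ {y} → ¬ InBox s′ (box (after (ι (inject₁ g))) (before (newName g))
                                       (after (ι (inject₁ g))) (before (ι (suc g)))) y
        none {y} inBox
          rewrite old (inject₁ g) | old (suc g) | fixedPoints-new s g x
          with ((l<y , y<x) , row) ← inBox = leftmost y<x ((l<y , <-trans y<x (proj₂ (proj₁ x∈))) , row)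

  -- Induction on the certificate follows the branch that the given permutation realises; every leaf
  -- other than `complete` is contradictory.
  certificate-sound : ∀ {s : Vec ℕ (suc m)} {S} (c : Certificate m) → Valid c S → Model s S → IsTarget
  certificate-sound vacant       v             M = contradiction v (vacant-sound M)
  certificate-sound complete     (eq , v)      M = complete-sound M eq v
  certificate-sound (interval B) (nontriv , v) M = contradiction v (interval-sound M B nontriv)
  certificate-sound {s = s} (above g h c d) (g<h , v , w) M
    -- The exclusive bound covers all coordinates up to the sentinel n + 1.
    with leastBelow (inCell? s g h) (suc (suc n))
  ... | inj₂ none                = certificate-sound d w (addEmpty-model M none)
  ... | inj₁ (x , x∈ , leftmost) = certificate-sound c v (addCycle-model M (<⇒≤ g<h)
    (gap-mono-< (embedding M) g<h (proj₁ x∈) (proj₂ x∈)) x∈ leftmost)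
  certificate-sound {s = s} (diagonal g c d e) (v , w , z) M
    with leastBelow (inCell? s g g) (suc (suc n))
  ... | inj₂ none = certificate-sound e z (addEmpty-model M none)
  ... | inj₁ (x , x∈ , leftmost) with <-cmp x (P x)
  ... | tri< x<Px _ _ = certificate-sound d w (addCycle-model M ≤-refl x<Px x∈ leftmost)
  ... | tri≈ _ x≡Px _ = certificate-sound c v (addFixed-model M (sym x≡Px) x∈ leftmost)
  -- A diagonal cell is its own mirror image, so `P x` would be an entry of it further left.
  ... | tri> _ _ Px<x = contradiction (proj₂ x∈ , subst (InGap s g) (sym (involutive x)) (proj₁ x∈)) (leftmost Px<x)

  certified-sound : ∀ {s : Vec ℕ (suc m)} {S} → Certified S → Model s S → IsTarget
  certified-sound (certify c v) = certificate-sound c (toWitness v)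

  -- From an occurrence of 123 to one of the two initial states

  module _ (x y z : ℕ) (0<x : 0 < x) (x<y : x < y) (y<z : y < z) (z<1+n : z < suc n)
           (0<Px : 0 < P x) (Px<Py : P x < P y) (Py<Pz : P y < P z) (Pz<1+n : P z < suc n) where
    private
      z≤1+n = <⇒≤ z<1+n
      y<1+n = <-trans y<z z<1+n
      x≤1+n = <⇒≤ (<-trans x<y y<1+n)
      0<y = <-trans 0<x x<y
      Py<1+n = <-trans Py<Pz Pz<1+n

    fixedMiddle-model : P y ≡ y → Model (0 ∷ y ∷ suc n ∷ []) fixedMiddle
    fixedMiddle-model Py≡y = record
      { embedding = record
        { increasing = λ { zero → 0<y ; (suc zero) → y<1+n }
        ; zero↦0     = refl
        ; last↦1+n   = refl
        ; commutes   = λ { zero → fixes-zero ; (suc zero) → Py≡y ; (suc (suc zero)) → fixes-last }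
        }
      ; isEmpty  = []
      ; hasPoint = (x , x≤1+n , (0<x , x<y) , 0<Px , subst (P x <_) Py≡y Px<Py)
                 ∷ (z , z≤1+n , (y<z , z<1+n) , subst (_< P z) Py≡y Py<Pz , Pz<1+n) ∷ []
      }

    excedanceMiddle-model : y < P y → Model (0 ∷ y ∷ P y ∷ suc n ∷ []) excedanceMiddle
    excedanceMiddle-model y<Py = record
      { embedding = record
        { increasing = λ { zero → 0<y ; (suc zero) → y<Py ; (suc (suc zero)) → Py<1+n }
        ; zero↦0     = refl
        ; last↦1+n   = refl
        ; commutes   = λ { zero → fixes-zero ; (suc zero) → refl ; (suc (suc zero)) → involutive y
                         ; (suc (suc (suc zero))) → fixes-last }
        }
      ; isEmpty  = []
      ; hasPoint = (x , x≤1+n , (0<x , x<y) , 0<Px , Px<Py)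
                 ∷ (z , z≤1+n , (y<z , z<1+n) , Py<Pz , Pz<1+n) ∷ []
      }

  123⇒target : ∀ {x y z} → 0 < x → x < y → y < z → z < suc n →
               0 < P x → P x < P y → P y < P z → P z < suc n → IsTarget
  123⇒target {x} {y} {z} 0<x x<y y<z z< 0<Px Px<Py Py<Pz Pz< with <-cmp y (P y)
  ... | tri≈ _ y≡Py _ = certified-sound fixedMiddle-certified
    (fixedMiddle-model x y z 0<x x<y y<z z< 0<Px Px<Py Py<Pz Pz< (sym y≡Py))
  ... | tri< y<Py _ _ = certified-sound excedanceMiddle-certified
    (excedanceMiddle-model x y z 0<x x<y y<z z< 0<Px Px<Py Py<Pz Pz< y<Py)
  -- Reflection in the diagonal gives the 123 at `P x`, `P y`, `P z`, whose middle is an excedance.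
  ... | tri> _ _ Py<y = certified-sound excedanceMiddle-certified
    (excedanceMiddle-model (P x) (P y) (P z) 0<Px Px<Py Py<Pz Pz<
      (subst (0 <_) (sym (involutive x)) 0<x)
      (subst₂ _<_ (sym (involutive x)) (sym (involutive y)) x<y)
      (subst₂ _<_ (sym (involutive y)) (sym (involutive z)) y<z)
      (subst (_< suc n) (sym (involutive z)) z<)
      (subst (P y <_) (sym (involutive y)) Py<y))

-- Pattern containment and explicit occurrences

module _ {n k} (π : Permutation′ n) (σ : Permutation′ (suc k)) where

  -- The vector `r` holds the values of the occurrence in increasing order, so that the values of
  -- `σ` are ranks in it and order is both preserved and reflected.
  increasing⇒contains : (f : Vec (Fin n) (suc k)) (r : Vec ℕ (suc k)) →
                        Increasing (Vec.map toℕ f) → Increasing r →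
                        (∀ i → toℕ (π ⟨$⟩ʳ lookup f i) ≡ lookup r (σ ⟨$⟩ʳ i)) → Contains π σ
  increasing⇒contains f r f-inc r-inc rank = lookup f ,
    (λ a b a<b → subst₂ _<_ (lookup-map a toℕ f) (lookup-map b toℕ f) (lookup-mono-< (Vec.map toℕ f) f-inc a<b)) ,
    (λ a b → mk⇔
      (λ σa<σb → subst₂ _<_ (sym (rank a)) (sym (rank b)) (lookup-mono-< r r-inc σa<σb))
      (λ πa<πb → lookup-cancel-< r r-inc (subst₂ _<_ (rank a) (rank b) πa<πb)))

  module _ (w : Vec ℕ (suc k)) (σ-w : HasOneLine σ w) (c : Contains π σ) where

    contains⇒< : ∀ i j → lookup w i < lookup w j → π ⟨$⟩ʳ proj₁ c i Fin.< π ⟨$⟩ʳ proj₁ c j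
    contains⇒< i j wi<wj =
      Equivalence.to (proj₂ (proj₂ c) i j) (subst₂ _<_ (sym (σ-w i)) (sym (σ-w j)) wi<wj)

-- Avoidance is stated for every permutation with the given one-line form; applying it takes an
-- actual one. The second vector is the inverse.
cycle2341 : Permutation′ 4
cycle2341 = permutation (lookup (# 1 ∷ # 2 ∷ # 3 ∷ # 0 ∷ [])) (lookup (# 3 ∷ # 0 ∷ # 1 ∷ # 2 ∷ []))
  (toWitness {a? = all? λ i → _ Fin.≟ i} tt) (toWitness {a? = all? λ i → _ Fin.≟ i} tt)

module _ {n} (π : Permutation′ n) where

  avoids123⇒¬has123 : Avoids123 π → ¬ Has123 (π ⟨$⟩ʳ_)
  avoids123⇒¬has123 av (a , b , (a<b , πa<πb) , c , (b<c , πb<πc)) =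
    av id↔ (λ { zero → refl ; (suc zero) → refl ; (suc (suc zero)) → refl })
      (increasing⇒contains π id↔ (a ∷ b ∷ c ∷ [])
        (toℕ (π ⟨$⟩ʳ a) ∷ toℕ (π ⟨$⟩ʳ b) ∷ toℕ (π ⟨$⟩ʳ c) ∷ [])
        (λ { zero → a<b ; (suc zero) → b<c }) (λ { zero → πa<πb ; (suc zero) → πb<πc })
        (λ { zero → refl ; (suc zero) → refl ; (suc (suc zero)) → refl }))

  ¬has123⇒avoids123 : ¬ Has123 (π ⟨$⟩ʳ_) → Avoids123 π
  ¬has123⇒avoids123 ¬has σ σ-w c@(f , mono , _) = ¬has
    ( f (# 0) , f (# 1) , (mono (# 0) (# 1) (s≤s z≤n) , values (# 0) (# 1) (s≤s z≤n))
    , f (# 2) , (mono (# 1) (# 2) (s≤s (s≤s z≤n)) , values (# 1) (# 2) (s≤s (s≤s z≤n))))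
    where values = contains⇒< π σ (0 ∷ 1 ∷ 2 ∷ []) σ-w c

  avoids2341⇒¬has2341 : Avoids2341 π → ¬ Has2341 (π ⟨$⟩ʳ_)
  avoids2341⇒¬has2341 av (a , b , (a<b , πa<πb) , c , (b<c , πb<πc) , d , (c<d , πd<πa)) =
    av cycle2341
      (λ { zero → refl ; (suc zero) → refl ; (suc (suc zero)) → refl ; (suc (suc (suc zero))) → refl })
      (increasing⇒contains π cycle2341 (a ∷ b ∷ c ∷ d ∷ [])
        (toℕ (π ⟨$⟩ʳ d) ∷ toℕ (π ⟨$⟩ʳ a) ∷ toℕ (π ⟨$⟩ʳ b) ∷ toℕ (π ⟨$⟩ʳ c) ∷ [])
        (λ { zero → a<b ; (suc zero) → b<c ; (suc (suc zero)) → c<d })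
        (λ { zero → πd<πa ; (suc zero) → πa<πb ; (suc (suc zero)) → πb<πc })
        (λ { zero → refl ; (suc zero) → refl ; (suc (suc zero)) → refl ; (suc (suc (suc zero))) → refl }))

  ¬has2341⇒avoids2341 : ¬ Has2341 (π ⟨$⟩ʳ_) → Avoids2341 π
  ¬has2341⇒avoids2341 ¬has σ σ-w c@(f , mono , _) = ¬has
    ( f (# 0) , f (# 1) , (mono (# 0) (# 1) (s≤s z≤n) , values (# 0) (# 1) (s≤s (s≤s z≤n)))
    , f (# 2) , (mono (# 1) (# 2) (s≤s (s≤s z≤n)) , values (# 1) (# 2) (s≤s (s≤s (s≤s z≤n))))
    , f (# 3) , (mono (# 2) (# 3) (s≤s (s≤s (s≤s z≤n))) , values (# 3) (# 0) (s≤s z≤n)))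
    where values = contains⇒< π σ (1 ∷ 2 ∷ 3 ∷ 0 ∷ []) σ-w c

  -- The first three entries of a 2341 form a 123.
  avoids123⇒avoids2341 : Avoids123 π → Avoids2341 π
  avoids123⇒avoids2341 av = ¬has2341⇒avoids2341
    λ (a , b , ab , c , bc , _) → avoids123⇒¬has123 av (a , b , ab , c , bc)

-- Extending a permutation to ℕ

module Extension {n : ℕ} (π : Permutation′ n) (involution : IsInvolution π) where

  -- Being the identity beyond n, it is an involution of all of ℕ and fixes the sentinel n + 1.
  extend : ℕ → ℕ
  extend zero = zero
  extend (suc x) with x ℕ.<? n
  ... | yes x<n = suc (toℕ (π ⟨$⟩ʳ Fin.fromℕ< x<n))
  ... | no  _   = suc x

  extend-toℕ : ∀ i → extend (suc (toℕ i)) ≡ suc (toℕ (π ⟨$⟩ʳ i))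
  extend-toℕ i with toℕ i ℕ.<? n
  ... | yes i<n = cong (λ j → suc (toℕ (π ⟨$⟩ʳ j))) (Fin.fromℕ<-toℕ i i<n)
  ... | no  i≮n = contradiction (Fin.toℕ<n i) i≮n

  extend-beyond : ∀ {x} → n ≤ x → extend (suc x) ≡ suc x
  extend-beyond {x} n≤x with x ℕ.<? n
  ... | yes x<n = contradiction n≤x (<⇒≱ x<n)
  ... | no  _   = refl

  index : ∀ {x} → 0 < x → x < suc n → Σ (Fin n) λ i → x ≡ suc (toℕ i)
  index {suc x} _ 1+x<1+n = Fin.fromℕ< (s≤s⁻¹ 1+x<1+n) , cong suc (sym (Fin.toℕ-fromℕ< _))

  extend-involutive : ∀ x → extend (extend x) ≡ x
  extend-involutive zero = refl
  extend-involutive (suc x) with x ℕ.<? n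
  ... | no  x≮n = extend-beyond (≮⇒≥ x≮n)
  ... | yes x<n = trans (extend-toℕ _) (cong suc (trans (cong toℕ (involution _)) (Fin.toℕ-fromℕ< x<n)))

  extend-bounded : ∀ {x} → x ≤ suc n → extend x ≤ suc n
  extend-bounded {zero}  _ = z≤n
  extend-bounded {suc x} x≤ with x ℕ.<? n
  ... | yes x<n = s≤s (<⇒≤ (Fin.toℕ<n _))
  ... | no  _   = x≤

  extend-injective : ∀ {x y} → extend x ≡ extend y → x ≡ y
  extend-injective {x} {y} eq =
    trans (sym (extend-involutive x)) (trans (cong extend eq) (extend-involutive y))

  extend-avoids-inside : Avoids2341 π → ∀ (i j k l : Fin n) {a b c d} →
                         a ≡ suc (toℕ i) → b ≡ suc (toℕ j) → c ≡ suc (toℕ k) → d ≡ suc (toℕ l) →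
                         a < b → b < c → c < d →
                         extend a < extend b → extend b < extend c → ¬ extend d < extend a
  extend-avoids-inside av i j k l refl refl refl refl i<j j<k k<l Pi<Pj Pj<Pk Pl<Pi =
    avoids2341⇒¬has2341 π av
    ( i , j , (s≤s⁻¹ i<j , reflects-< i j Pi<Pj)
    , k , (s≤s⁻¹ j<k , reflects-< j k Pj<Pk)
    , l , (s≤s⁻¹ k<l , reflects-< l i Pl<Pi))
    where
    reflects-< : ∀ u v → extend (suc (toℕ u)) < extend (suc (toℕ v)) → π ⟨$⟩ʳ u Fin.< π ⟨$⟩ʳ v
    reflects-< u v lt = s≤s⁻¹ (subst₂ _<_ (extend-toℕ u) (extend-toℕ v) lt)

  extend-positive : ∀ {x y} → y < extend x → 0 < x
  extend-positive {suc x} _ = s≤s z≤n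

  -- No sentinel takes part in a 2341: the value at `a` exceeds another one, so `a` is not 0, and
  -- the last entry lies below the first, so `d` is not n + 1.
  extend-avoids : Avoids2341 π → ∀ {a b c d} → a < b → b < c → c < d → d ≤ suc n →
                  extend a < extend b → extend b < extend c → ¬ extend d < extend a
  extend-avoids av {a} {b} {c} {d} a<b b<c c<d d≤ Pa<Pb Pb<Pc Pd<Pa with m≤n⇒m<n∨m≡n d≤
  ... | inj₂ refl = contradiction (extend-bounded (<⇒≤ (<-trans a<b (<-trans b<c c<d))))
    (<⇒≱ (subst (_< extend a) (extend-beyond ≤-refl) Pd<Pa))
  ... | inj₁ d<1+n = extend-avoids-inside av _ _ _ _ (proj₂ (index 0<a (<-trans a<b b<1+n)))
    (proj₂ (index (<-trans 0<a a<b) b<1+n)) (proj₂ (index (<-trans 0<a (<-trans a<b b<c)) c<1+n))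
    (proj₂ (index (<-trans 0<a (<-trans a<b (<-trans b<c c<d))) d<1+n)) a<b b<c c<d Pa<Pb Pb<Pc Pd<Pa
    where
    0<a = extend-positive Pd<Pa
    c<1+n = <-trans c<d d<1+n
    b<1+n = <-trans b<c c<1+n

  -- Pigeonhole principle for the injective map `extend`.
  range-size : ∀ {l r b t} → (∀ {x} → l ≤ x → x < r → b ≤ extend x × extend x < t) → r ∸ l ≤ t ∸ b
  range-size {l} {r} {b} {t} maps = Fin.injective⇒≤ {f = image} image-injective
    where
    point : Fin (r ∸ l) → ℕ
    point k = l + toℕ k

    point<r : ∀ k → point k < r
    point<r k = <-≤-trans (+-monoʳ-< l (Fin.toℕ<n k))
      (≤-reflexive (m+[n∸m]≡n {l} {r} (<⇒≤ (m∸n≢0⇒n<m (nonzero k)))))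
      where
      nonzero : ∀ {q} → Fin q → q ≢ 0
      nonzero zero ()

    bounds : ∀ k → b ≤ extend (point k) × extend (point k) < t
    bounds k = maps (m≤m+n l (toℕ k)) (point<r k)

    image : Fin (r ∸ l) → Fin (t ∸ b)
    image k = Fin.fromℕ< (∸-monoˡ-< (proj₂ (bounds k)) (proj₁ (bounds k)))

    image-injective : ∀ {j k} → image j ≡ image k → j ≡ k
    image-injective {j} {k} eq = Fin.toℕ-injective (+-cancelˡ-≡ l _ _ (extend-injective
      (∸-cancelʳ-≡ (proj₁ (bounds j)) (proj₁ (bounds k))
        (trans (sym (Fin.toℕ-fromℕ< _)) (trans (cong toℕ eq) (Fin.toℕ-fromℕ< _))))))

  -- The definition of an interval asks for as many consecutive values as positions; the two ranges
  -- have equal size because `extend` maps each into the other.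
  extend-simple : IsSimple π → ∀ {l r b t} →
                  (∀ {x} → x ≤ suc n → l ≤ x → x < r → b ≤ extend x × extend x < t) →
                  (∀ {x} → x ≤ suc n → b ≤ extend x → extend x < t → l ≤ x × x < r) →
                  1 ≤ l → r ≤ suc n → 1 ≤ b → t ≤ suc n → suc l < r → l ≤ 1 × suc n ≤ r
  -- After this match, the columns l + 1 to r + 1 are the positions l to r of `π`.
  extend-simple simple {suc l} {suc (suc r)} {suc b} {t} to from _ (s≤s r<n) _ t≤ (s≤s (s≤s l<r)) =
    conclude (simple i j (i≤j , b , isImage))
    where
    l<n : l < n
    l<n = <-trans l<r r<n

    i j : Fin n
    i = Fin.fromℕ< l<n
    j = Fin.fromℕ< r<n

    i≡l : toℕ i ≡ l
    i≡l = Fin.toℕ-fromℕ< l<n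

    j≡r : toℕ j ≡ r
    j≡r = Fin.toℕ-fromℕ< r<n

    i≤j : i Fin.≤ j
    i≤j = subst₂ _≤_ (sym i≡l) (sym j≡r) (<⇒≤ l<r)

    size : suc r ∸ l ≡ t ∸ suc b
    size = ≤-antisym
      (range-size λ l≤x x<r → to (<⇒≤ (<-≤-trans x<r (s≤s r<n))) l≤x x<r)
      (range-size λ {x} b≤x x<t → from (extend-bounded (≤-trans (<⇒≤ x<t) t≤))
        (subst (suc b ≤_) (sym (extend-involutive x)) b≤x) (subst (_< t) (sym (extend-involutive x)) x<t))

    t≡ : t ≡ suc (suc (b + (toℕ j ∸ toℕ i)))
    t≡ = begin
      t                             ≡⟨ m+[n∸m]≡n b<t ⟨
      suc (b + (t ∸ suc b))         ≡⟨ cong (λ y → suc (b + y)) size ⟨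
      suc (b + (suc r ∸ l))         ≡⟨ cong (λ y → suc (b + y)) (+-∸-assoc 1 (<⇒≤ l<r)) ⟩
      suc (b + suc (r ∸ l))         ≡⟨ cong suc (+-suc b (r ∸ l)) ⟩
      suc (suc (b + (r ∸ l)))       ≡⟨ cong₂ (λ y x → suc (suc (b + (y ∸ x)))) j≡r i≡l ⟨
      suc (suc (b + (toℕ j ∸ toℕ i))) ∎
      where
      open ≡-Reasoning
      b<t : suc b ≤ t
      b<t = <⇒≤ (m∸n≢0⇒n<m λ t∸b≡0 → m>n⇒m∸n≢0 {suc r} {l} (m<n⇒m<1+n l<r) (trans size t∸b≡0))

    isImage : ∀ v → (∃[ p ] i Fin.≤ p × p Fin.≤ j × π ⟨$⟩ʳ p ≡ v) ⇔
                    (b ≤ toℕ v × toℕ v ≤ b + (toℕ j ∸ toℕ i))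
    isImage v = mk⇔ forth back
      where
      forth : (∃[ p ] i Fin.≤ p × p Fin.≤ j × π ⟨$⟩ʳ p ≡ v) → b ≤ toℕ v × toℕ v ≤ b + (toℕ j ∸ toℕ i)
      forth (p , i≤p , p≤j , refl)
        with to (s≤s (<⇒≤ (Fin.toℕ<n p))) (s≤s (subst (_≤ toℕ p) i≡l i≤p))
               (s≤s (s≤s (subst (toℕ p ≤_) j≡r p≤j)))
      ... | b≤ , <t rewrite extend-toℕ p | t≡ = s≤s⁻¹ b≤ , s≤s⁻¹ (s≤s⁻¹ <t)

      back : b ≤ toℕ v × toℕ v ≤ b + (toℕ j ∸ toℕ i) → ∃[ p ] i Fin.≤ p × p Fin.≤ j × π ⟨$⟩ʳ p ≡ v
      -- Since `π` is its own inverse, the value `v` is taken at position `π ⟨$⟩ʳ v`.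
      back (b≤v , v≤)
        with from (s≤s (<⇒≤ (Fin.toℕ<n (π ⟨$⟩ʳ v))))
               (subst (suc b ≤_) (sym value) (s≤s b≤v)) (subst₂ _<_ (sym value) (sym t≡) (s≤s (s≤s v≤)))
        where
        value : extend (suc (toℕ (π ⟨$⟩ʳ v))) ≡ suc (toℕ v)
        value = trans (extend-toℕ (π ⟨$⟩ʳ v)) (cong (suc ∘ toℕ) (involution v))
      ... | l≤ , <r = π ⟨$⟩ʳ v , subst (_≤ toℕ (π ⟨$⟩ʳ v)) (sym i≡l) (s≤s⁻¹ l≤)
                    , subst (toℕ (π ⟨$⟩ʳ v) ≤_) (sym j≡r) (s≤s⁻¹ (s≤s⁻¹ <r)) , involution v

    conclude : suc (toℕ j ∸ toℕ i) ≡ 1 ⊎ suc (toℕ j ∸ toℕ i) ≡ n → suc l ≤ 1 × suc n ≤ suc (suc r)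
    conclude (inj₁ eq) = contradiction (trans (sym (cong₂ _∸_ j≡r i≡l)) (suc-injective eq)) (m>n⇒m∸n≢0 l<r)
    conclude (inj₂ eq) = s≤s (≮⇒≥ ¬0<l) , s≤s (subst (_≤ suc r) n≡ (s≤s (m∸n≤m r l)))
      where
      n≡ : suc (r ∸ l) ≡ n
      n≡ = trans (cong suc (sym (cong₂ _∸_ j≡r i≡l))) eq
      ¬0<l : ¬ 0 < l
      ¬0<l 0<l = <⇒≱ r<n (subst (_≤ r) n≡ (∸-monoʳ-< 0<l (<⇒≤ l<r)))

  extendedSimple : IsSimple π → Avoids2341 π → ExtendedSimple n extend
  extendedSimple simple av = record
    { involutive = extend-involutive
    ; fixes-zero = refl
    ; fixes-last = extend-beyond ≤-refl
    ; bounded    = extend-bounded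
    ; avoids     = extend-avoids av
    ; simple     = extend-simple simple
    }

  has123⇒5274163 : IsSimple π → Avoids2341 π → Has123 (π ⟨$⟩ʳ_) → Is5274163 π
  has123⇒5274163 simple av (a , b , (a<b , πa<πb) , c , (b<c , πb<πc)) = conclude
    (123⇒target (s≤s z≤n) (s≤s a<b) (s≤s b<c) (s≤s (Fin.toℕ<n c))
      (subst (0 <_) (sym (extend-toℕ a)) (s≤s z≤n)) (mono a b πa<πb) (mono b c πb<πc)
      (subst (_< suc n) (sym (extend-toℕ c)) (s≤s (Fin.toℕ<n _))))
    where
    open Soundness n extend (extendedSimple simple av)

    mono : ∀ u v → π ⟨$⟩ʳ u Fin.< π ⟨$⟩ʳ v → extend (suc (toℕ u)) < extend (suc (toℕ v))
    mono u v πu<πv = subst₂ _<_ (sym (extend-toℕ u)) (sym (extend-toℕ v)) (s≤s πu<πv)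

    conclude : IsTarget → Is5274163 π
    -- Position `i` of `π` bears the name `suc (inject₁ i)`, one past the sentinel 0.
    conclude (refl , values) = refl , λ i → suc-injective (trans (sym (extend-toℕ i))
      (trans (cong (extend ∘ suc) (sym (Fin.toℕ-inject₁ i))) (trans (values (suc (inject₁ i)))
        (toWitness {a? = all? λ i → toℕ (lookup target (suc (inject₁ i))) ℕ.≟
                                    suc (lookup (4 ∷ 1 ∷ 6 ∷ 3 ∷ 0 ∷ 5 ∷ 2 ∷ []) i)} tt i))))

-- 5274163 is a simple involution avoiding 2341

oneLine : Vec (Fin 7) 7
oneLine = # 4 ∷ # 1 ∷ # 6 ∷ # 3 ∷ # 0 ∷ # 5 ∷ # 2 ∷ []

-- The values at positions i, …, j are not consecutive if a value between two of them is taken at a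
-- position r outside.
TrivialOrSplit : Fin 7 → Fin 7 → Set
TrivialOrSplit i j = (suc (toℕ j ∸ toℕ i) ≡ 1 ⊎ suc (toℕ j ∸ toℕ i) ≡ 7) ⊎
  ∃[ p ] ∃[ q ] ∃[ r ] (i Fin.≤ p × p Fin.≤ j) × (i Fin.≤ q × q Fin.≤ j) × ¬ (i Fin.≤ r × r Fin.≤ j) ×
    lookup oneLine p Fin.≤ lookup oneLine r × lookup oneLine r Fin.≤ lookup oneLine q

trivialOrSplit? : Dec (∀ i j → i Fin.≤ j → TrivialOrSplit i j)
trivialOrSplit? = all? λ i → all? λ j → (i Fin.≤? j) →-dec
  ((suc (toℕ j ∸ toℕ i) ℕ.≟ 1 ⊎-dec suc (toℕ j ∸ toℕ i) ℕ.≟ 7) ⊎-dec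
  any? λ p → any? λ q → any? λ r → (i Fin.≤? p ×-dec p Fin.≤? j) ×-dec (i Fin.≤? q ×-dec q Fin.≤? j) ×-dec
    ¬? (i Fin.≤? r ×-dec r Fin.≤? j) ×-dec
    lookup oneLine p Fin.≤? lookup oneLine r ×-dec lookup oneLine r Fin.≤? lookup oneLine q)

module _ {π : Permutation′ 7} (π≗ : ∀ i → π ⟨$⟩ʳ i ≡ lookup oneLine i) where

  5274163-involution : IsInvolution π
  5274163-involution i = trans (π≗ _) (trans (cong (lookup oneLine) (π≗ i))
    (toWitness {a? = all? λ i → lookup oneLine (lookup oneLine i) Fin.≟ i} tt i))

  5274163-avoids2341 : Avoids2341 π
  5274163-avoids2341 = ¬has2341⇒avoids2341 π λ (a , b , (a<b , ab) , c , (b<c , bc) , d , (c<d , da)) →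
    toWitness {a? = ¬? (has2341? (lookup oneLine))} tt
      (a , b , (a<b , transport ab) , c , (b<c , transport bc) , d , (c<d , transport da))
    where
    transport : ∀ {i j} → π ⟨$⟩ʳ i Fin.< π ⟨$⟩ʳ j → lookup oneLine i Fin.< lookup oneLine j
    transport {i} {j} = subst₂ Fin._<_ (π≗ i) (π≗ j)

  -- The value at `r` lies between two values of the interval, hence is taken inside it, and
  -- injectivity puts `r` inside as well.
  trivialOrSplit⇒trivial : ∀ {i j} → IsInterval π i j → TrivialOrSplit i j →
                           suc (toℕ j ∸ toℕ i) ≡ 1 ⊎ suc (toℕ j ∸ toℕ i) ≡ 7
  trivialOrSplit⇒trivial _ (inj₁ trivial) = trivial
  trivialOrSplit⇒trivial {i} {j} (_ , a , isImage)
    (inj₂ (p , q , r , (i≤p , p≤j) , (i≤q , q≤j) , r∉ , p≤r , r≤q)) =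
      let r′ , i≤r′ , r′≤j , πr′≡πr = attained in
      contradiction
        (subst (λ v → i Fin.≤ v × v Fin.≤ j) (Injection.injective (↔⇒↣ π) πr′≡πr) (i≤r′ , r′≤j)) r∉
    where
    transport : ∀ {u v} → lookup oneLine u Fin.≤ lookup oneLine v → π ⟨$⟩ʳ u Fin.≤ π ⟨$⟩ʳ v
    transport {u} {v} = subst₂ Fin._≤_ (sym (π≗ u)) (sym (π≗ v))

    attained : ∃[ p ] i Fin.≤ p × p Fin.≤ j × π ⟨$⟩ʳ p ≡ π ⟨$⟩ʳ r
    attained = Equivalence.from (isImage (π ⟨$⟩ʳ r))
      ( ≤-trans (proj₁ (Equivalence.to (isImage _) (p , i≤p , p≤j , refl))) (transport p≤r)
      , ≤-trans (transport r≤q) (proj₂ (Equivalence.to (isImage _) (q , i≤q , q≤j , refl))))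

  5274163-simple : IsSimple π
  5274163-simple i j int = trivialOrSplit⇒trivial int (toWitness {a? = trivialOrSplit?} tt i j (proj₁ int))

is5274163⇒simpleInvolution : ∀ {n} (π : Permutation′ n) → Is5274163 π →
                             IsSimple π × IsInvolution π × Avoids2341 π
is5274163⇒simpleInvolution π (refl , values) =
  5274163-simple {π = π} π≗ , 5274163-involution {π = π} π≗ , 5274163-avoids2341 {π = π} π≗
  where
  π≗ : ∀ i → π ⟨$⟩ʳ i ≡ lookup oneLine i
  π≗ i = Fin.toℕ-injective (trans (values i)
    (toWitness {a? = all? λ i → lookup (Vec.map toℕ oneLine) i ℕ.≟ toℕ (lookup oneLine i)} tt i))

-- Both inclusions, split by whether `π` has a 123

theorem3p6 : ∀ (n : ℕ) (π : Permutation′ n) →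
    (IsSimple π × IsInvolution π × Avoids2341 π) ⇔
    ((IsSimple π × IsInvolution π × Avoids123 π) ⊎ Is5274163 π)
theorem3p6 n π = mk⇔ forth back
  where
  forth : IsSimple π × IsInvolution π × Avoids2341 π →
          (IsSimple π × IsInvolution π × Avoids123 π) ⊎ Is5274163 π
  forth (simple , inv , av) with has123? (π ⟨$⟩ʳ_)
  ... | yes has = inj₂ (Extension.has123⇒5274163 π inv simple av has)
  ... | no ¬has = inj₁ (simple , inv , ¬has123⇒avoids123 π ¬has)

  back : (IsSimple π × IsInvolution π × Avoids123 π) ⊎ Is5274163 π →
         IsSimple π × IsInvolution π × Avoids2341 π
  back (inj₁ (simple , inv , av)) = simple , inv , avoids123⇒avoids2341 π av
  back (inj₂ is)                  = is5274163⇒simpleInvolution π is
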